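{- There exist two irregular bipartite graphs $G_1$ and $G_2$ that have the same spectrum, the same degree sequences and the same girth $6$, but have different numbers of $6$-cycles. Specifically, $G_1=2C_6\cup 2P_6$ (the disjoint union of two $6$-cycles and two paths with $6$ nodes) and $G_2=C_6\cup C_{14}\cup 2P_2$ (the disjoint union of a $6$-cycle, a $14$-cycle and two paths with $2$ nodes) have these properties.
   Context: All graphs are finite, simple and undirected. $C_k$ denotes a cycle of length $k$ and $P_n$ a path with $n$ nodes. The spectrum of a graph is the multiset of eigenvalues of its adjacency matrix. The degree sequences of a bipartite graph are the two monotonic non-increasing sequences of the node degrees on the two sides of a bipartition; two graphs have the same degree sequences if these coincide for suitable bipartitions. A bipartite graph is bi-regular if all nodes on the same side have the same degree, and irregular if it is not bi-regular. The girth is the length of a shortest cycle. -}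

module Defs where

open import Algebra.Bundles using (CommutativeRing)
import Algebra.Definitions.RawMonoid as RawMonoidSum
open import Data.Bool.Base using (Bool; if_then_else_)
import Data.Bool.Properties as Bool
open import Data.Fin.Base using (Fin; toℕ; splitAt)
import Data.Fin.Properties as Fin
open import Data.List.Base using (List; allFin; filter; length; map)
import Data.List.Sort as Sort
open import Data.Nat.Base as ℕ using (ℕ; suc; s≤s; z≤n)
open import Data.Nat.DivMod using (_mod_; _%_; m<n⇒m%n≡m; n%n≡0; m%n<n)
import Data.Nat.Properties as ℕ
open import Data.Product.Base using (Σ; ∃-syntax; _×_; _,_)
open import Data.Rational.Base as ℚ using (ℚ; 0ℚ; 1ℚ; ½)
import Data.Rational.Properties as ℚ
open import Data.Rational.Solver using (module +-*-Solver)
open import Data.Sum.Base as Sum using (_⊎_; inj₁; inj₂)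
open import Data.Sum.Relation.Binary.Pointwise as Sum using (Pointwise; inj₁; inj₂)
open import Data.Vec.Functional using (Vector)
open import Function.Base using (case_of_)
open import Function.Bundles using (Inverse; _⇔_)
open import Function.Construct.Composition using (_⇔-∘_)
open import Function.Construct.Identity using (⇔-id)
open import Function.Construct.Symmetry using (⇔-sym)
open import Function.Definitions using (Injective)
open import Level using (0ℓ; _⊔_)
open import Relation.Binary.Bundles using (Setoid)
import Relation.Binary.Construct.Flip.EqAndOrd as Flip
open import Relation.Binary.Core using (Rel)
open import Relation.Binary.Definitions using (Decidable; Irreflexive; Symmetric)
open import Relation.Binary.PropositionalEquality
  using (_≡_; _≢_; refl; sym; trans; cong; subst; setoid)
open import Relation.Nullary using (¬_; does)
open import Relation.Nullary.Decidable using (True; toWitness; _⊎-dec_)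

-- Cauchy sequences of rationals up to null sequences; ℝ is used as a setoid.

module Real where

  open import Data.Rational.Base using (_+_; _*_; -_; _-_; ∣_∣; _<_)

  Cauchy : (ℕ → ℚ) → Set
  Cauchy s = ∀ ε → 0ℚ < ε →
    ∃[ N ] (∀ m n → N ℕ.≤ m → N ℕ.≤ n → ∣ s m - s n ∣ < ε)

  record ℝ : Set where
    constructor real
    field
      seq    : ℕ → ℚ
      cauchy : Cauchy seq

  open ℝ

  infix 4 _≃_

  record _≃_ (x y : ℝ) : Set where
    constructor equal
    field
      close : ∀ ε → 0ℚ < ε → ∃[ N ] (∀ n → N ℕ.≤ n → ∣ seq x n - seq y n ∣ < ε)

  open _≃_

  private

    open +-*-Solver

    half : ℚ → ℚ
    half ε = ε * ½

    half>0 : ∀ {ε} → 0ℚ < ε → 0ℚ < half ε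
    half>0 {ε} 0<ε =
      subst (_< half ε) (ℚ.*-zeroˡ ½) (ℚ.*-monoˡ-<-pos ½ 0<ε)

    half+half : ∀ ε → half ε + half ε ≡ ε
    half+half ε = trans (sym (ℚ.*-distribˡ-+ ε ½ ½)) (ℚ.*-identityʳ ε)

    <-halves : ∀ {p q ε} → p < half ε → q < half ε → p + q < ε
    <-halves {ε = ε} p< q< = subst (_ <_) (half+half ε) (ℚ.+-mono-< p< q<)

    triangle : ∀ {p q r ε} → r ≡ p + q → ∣ p ∣ < half ε → ∣ q ∣ < half ε → ∣ r ∣ < ε
    triangle {p} {q} refl p< q< =
      ℚ.≤-<-trans (ℚ.∣p+q∣≤∣p∣+∣q∣ p q) (<-halves p< q<)

    ∣p-p∣≡0 : ∀ p → ∣ p - p ∣ ≡ 0ℚ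
    ∣p-p∣≡0 p = cong ∣_∣ (ℚ.+-inverseʳ p)

    ∣p-q∣≡∣q-p∣ : ∀ p q → ∣ p - q ∣ ≡ ∣ q - p ∣
    ∣p-q∣≡∣q-p∣ p q =
      trans (sym (ℚ.∣-p∣≡∣p∣ (p - q)))
        (cong ∣_∣ (solve 2 (λ p q → :- (p :- q) := q :- p) refl p q))

    pointwise : ∀ {x y} → (∀ n → seq x n ≡ seq y n) → x ≃ y
    pointwise {x} {y} eq = equal λ ε 0<ε → 0 , λ n _ →
      subst (_< ε)
        (sym (trans (cong (λ z → ∣ z - seq y n ∣) (eq n)) (∣p-p∣≡0 (seq y n)))) 0<ε

    ≃-refl : ∀ {x} → x ≃ x
    ≃-refl {x} = pointwise {x} {x} λ _ → refl

    ≃-sym : ∀ {x y} → x ≃ y → y ≃ x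
    ≃-sym {x} {y} x≃y = equal λ ε 0<ε →
      let N , h = close x≃y ε 0<ε in N , λ n N≤n → subst (_< ε) (∣p-q∣≡∣q-p∣ (seq x n) (seq y n)) (h n N≤n)

    m≤ : ∀ {m n o} → m ℕ.⊔ n ℕ.≤ o → m ℕ.≤ o
    m≤ {m} {n} = ℕ.≤-trans (ℕ.m≤m⊔n m n)

    n≤ : ∀ {m n o} → m ℕ.⊔ n ℕ.≤ o → n ℕ.≤ o
    n≤ {m} {n} = ℕ.≤-trans (ℕ.m≤n⊔m m n)

    ≃-trans : ∀ {x y z} → x ≃ y → y ≃ z → x ≃ z
    ≃-trans {x} {y} {z} x≃y y≃z = equal λ ε 0<ε →
      let M , h = close x≃y (half ε) (half>0 0<ε)
          N , k = close y≃z (half ε) (half>0 0<ε)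
      in M ℕ.⊔ N , λ n ≤n → triangle {p = seq x n - seq y n}
      (solve 3 (λ a b c → a :- c := (a :- b) :+ (b :- c)) refl
        (seq x n) (seq y n) (seq z n))
      (h n (m≤ ≤n)) (k n (n≤ {M} ≤n))

    +-diff : ∀ a b c d → (a + b) - (c + d) ≡ (a - c) + (b - d)
    +-diff = solve 4 (λ a b c d → (a :+ b) :- (c :+ d) := (a :- c) :+ (b :- d)) refl

    *-diff : ∀ a b c d → (a * b) - (c * d) ≡ a * (b - d) + d * (a - c)
    *-diff = solve 4
      (λ a b c d → (a :* b) :- (c :* d) := a :* (b :- d) :+ d :* (a :- c)) refl

    neg-diff : ∀ a b → (- a) - (- b) ≡ b - a
    neg-diff = solve 2 (λ a b → (:- a) :- (:- b) := b :- a) refl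

    record Bounded (s : ℕ → ℚ) : Set where
      field
        bound : ℚ
        pos   : ℚ.Positive bound
        from  : ℕ
        below : ∀ n → from ℕ.≤ n → ∣ s n ∣ < bound

    0<1 : 0ℚ < 1ℚ
    0<1 = ℚ.positive⁻¹ 1ℚ

    bounded : ∀ x → Bounded (seq x)
    bounded x with cauchy x 1ℚ 0<1
    ... | N , h = record
      { bound = ∣ seq x N ∣ + 1ℚ
      ; pos   = ℚ.positive (ℚ.+-mono-≤-< (ℚ.0≤∣p∣ (seq x N)) 0<1)
      ; from  = N
      ; below = λ n N≤n → ℚ.≤-<-trans
          (subst (λ z → ∣ z ∣ ℚ.≤ ∣ seq x N ∣ + ∣ seq x n - seq x N ∣)
            (solve 2 (λ a b → b :+ (a :- b) := a) refl (seq x n) (seq x N))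
            (ℚ.∣p+q∣≤∣p∣+∣q∣ (seq x N) (seq x n - seq x N)))
          (ℚ.+-monoʳ-< ∣ seq x N ∣ (h n N N≤n ℕ.≤-refl))
      }

    module _ (b : ℚ) {{pos : ℚ.Positive b}} where

      private instance
        b≢0 : ℚ.NonZero b
        b≢0 = ℚ.pos⇒nonZero b

      shrink : ℚ → ℚ
      shrink ε = ℚ.1/ b * half ε

      shrink>0 : ∀ {ε} → 0ℚ < ε → 0ℚ < shrink ε
      shrink>0 {ε} 0<ε =
        subst (_< shrink ε) (ℚ.*-zeroʳ (ℚ.1/ b))
          (ℚ.*-monoʳ-<-pos (ℚ.1/ b) {{ℚ.1/pos⇒pos b}} (half>0 0<ε))

      scale : ∀ ε a d → ∣ a ∣ < b → ∣ d ∣ < shrink ε → ∣ a * d ∣ < half ε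
      scale ε a d a< d< = begin-strict
        ∣ a * d ∣              ≡⟨ ℚ.∣p*q∣≡∣p∣*∣q∣ a d ⟩
        ∣ a ∣ * ∣ d ∣          ≤⟨ ℚ.*-monoʳ-≤-nonNeg ∣ d ∣ {{ℚ.∣-∣-nonNeg d}} (ℚ.<⇒≤ a<) ⟩
        b * ∣ d ∣              <⟨ ℚ.*-monoʳ-<-pos b d< ⟩
        b * (ℚ.1/ b * half ε)  ≡⟨ sym (ℚ.*-assoc b (ℚ.1/ b) (half ε)) ⟩
        (b * ℚ.1/ b) * half ε  ≡⟨ cong (_* half ε) (ℚ.*-inverseʳ b) ⟩
        1ℚ * half ε            ≡⟨ ℚ.*-identityˡ (half ε) ⟩
        half ε                 ∎
        where open ℚ.≤-Reasoning

  private abstract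

    const-cauchy : ∀ q → Cauchy (λ _ → q)
    const-cauchy q ε 0<ε = 0 , λ _ _ _ _ → subst (_< ε) (sym (∣p-p∣≡0 q)) 0<ε

    +-cauchy : ∀ x y → Cauchy (λ n → seq x n + seq y n)
    +-cauchy x y ε 0<ε =
      let M , h = cauchy x (half ε) (half>0 0<ε)
          N , k = cauchy y (half ε) (half>0 0<ε)
      in M ℕ.⊔ N , λ m n ≤m ≤n → triangle
           (+-diff (seq x m) (seq y m) (seq x n) (seq y n))
           (h m n (m≤ ≤m) (m≤ ≤n)) (k m n (n≤ {M} ≤m) (n≤ {M} ≤n))

    neg-cauchy : ∀ x → Cauchy (λ n → - seq x n)
    neg-cauchy x ε 0<ε =
      let N , h = cauchy x ε 0<ε
      in N , λ m n ≤m ≤n →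
           subst (λ z → ∣ z ∣ < ε) (sym (neg-diff (seq x m) (seq x n))) (h n m ≤n ≤m)

    *-cauchy : ∀ x y → Cauchy (λ n → seq x n * seq y n)
    *-cauchy x y ε 0<ε =
      let open Bounded
          bx = bounded x
          by = bounded y
          instance
            px = pos bx
            py = pos by
          M , h = cauchy y (shrink (bound bx) ε) (shrink>0 (bound bx) 0<ε)
          N , k = cauchy x (shrink (bound by) ε) (shrink>0 (bound by) 0<ε)
      in (from bx ℕ.⊔ from by) ℕ.⊔ (M ℕ.⊔ N) , λ m n ≤m ≤n → triangle
           (*-diff (seq x m) (seq y m) (seq x n) (seq y n))
           (scale (bound bx) ε (seq x m) (seq y m - seq y n)
             (below bx m (m≤ (m≤ ≤m)))
             (h m n (m≤ (n≤ {from bx ℕ.⊔ from by} ≤m))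
                    (m≤ (n≤ {from bx ℕ.⊔ from by} ≤n))))
           (scale (bound by) ε (seq y n) (seq x m - seq x n)
             (below by n (n≤ {from bx} (m≤ ≤n)))
             (k m n (n≤ {M} (n≤ {from bx ℕ.⊔ from by} ≤m))
                    (n≤ {M} (n≤ {from bx ℕ.⊔ from by} ≤n))))

  infixl 6 _+ᴿ_
  infixl 7 _*ᴿ_
  infix  8 -ᴿ_

  fromℚ : ℚ → ℝ
  fromℚ q = real (λ _ → q) (const-cauchy q)

  _+ᴿ_ : ℝ → ℝ → ℝ
  x +ᴿ y = real (λ n → seq x n + seq y n) (+-cauchy x y)

  -ᴿ_ : ℝ → ℝ
  -ᴿ x = real (λ n → - seq x n) (neg-cauchy x)

  _*ᴿ_ : ℝ → ℝ → ℝ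
  x *ᴿ y = real (λ n → seq x n * seq y n) (*-cauchy x y)

  private

    +-cong : ∀ {x y u v} → x ≃ y → u ≃ v → x +ᴿ u ≃ y +ᴿ v
    +-cong {x} {y} {u} {v} p q = equal λ ε 0<ε →
      let M , h = close p (half ε) (half>0 0<ε)
          N , k = close q (half ε) (half>0 0<ε)
      in M ℕ.⊔ N , λ n ≤n → triangle
           (+-diff (seq x n) (seq u n) (seq y n) (seq v n))
           (h n (m≤ ≤n)) (k n (n≤ {M} ≤n))

    neg-cong : ∀ {x y} → x ≃ y → -ᴿ x ≃ -ᴿ y
    neg-cong {x} {y} p = equal λ ε 0<ε →
      let N , h = close (≃-sym p) ε 0<ε
      in N , λ n ≤n →
           subst (λ z → ∣ z ∣ < ε) (sym (neg-diff (seq x n) (seq y n))) (h n ≤n)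

    *-cong : ∀ {x y u v} → x ≃ y → u ≃ v → x *ᴿ u ≃ y *ᴿ v
    *-cong {x} {y} {u} {v} p q = equal λ ε 0<ε →
      let open Bounded
          bx = bounded x
          bv = bounded v
          instance
            px = pos bx
            pv = pos bv
          M , h = close q (shrink (bound bx) ε) (shrink>0 (bound bx) 0<ε)
          N , k = close p (shrink (bound bv) ε) (shrink>0 (bound bv) 0<ε)
      in (from bx ℕ.⊔ from bv) ℕ.⊔ (M ℕ.⊔ N) , λ n ≤n → triangle
           (*-diff (seq x n) (seq u n) (seq y n) (seq v n))
           (scale (bound bx) ε (seq x n) (seq u n - seq v n) (below bx n (m≤ (m≤ ≤n)))
             (h n (m≤ (n≤ {from bx ℕ.⊔ from bv} ≤n))))
           (scale (bound bv) ε (seq v n) (seq x n - seq y n) (below bv n (n≤ {from bx} (m≤ ≤n)))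
             (k n (n≤ {M} (n≤ {from bx ℕ.⊔ from bv} ≤n))))

  ℝ-commutativeRing : CommutativeRing 0ℓ 0ℓ
  ℝ-commutativeRing = record
    { Carrier = ℝ
    ; _≈_     = _≃_
    ; _+_     = _+ᴿ_
    ; _*_     = _*ᴿ_
    ; -_      = -ᴿ_
    ; 0#      = fromℚ 0ℚ
    ; 1#      = fromℚ 1ℚ
    ; isCommutativeRing = record
      { isRing = record
        { +-isAbelianGroup = record
          { isGroup = record
            { isMonoid = record
              { isSemigroup = record
                { isMagma = record
                  { isEquivalence = record
                    { refl  = ≃-refl
                    ; sym   = ≃-sym
                    ; trans = ≃-trans
                    }
                  ; ∙-cong = +-cong
                  }
                ; assoc = λ x y z → pointwise λ n →
                    ℚ.+-assoc (seq x n) (seq y n) (seq z n)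
                }
              ; identity = (λ x → pointwise λ n → ℚ.+-identityˡ (seq x n))
                         , (λ x → pointwise λ n → ℚ.+-identityʳ (seq x n))
              }
            ; inverse = (λ x → pointwise λ n → ℚ.+-inverseˡ (seq x n))
                      , (λ x → pointwise λ n → ℚ.+-inverseʳ (seq x n))
            ; ⁻¹-cong = neg-cong
            }
          ; comm = λ x y → pointwise λ n → ℚ.+-comm (seq x n) (seq y n)
          }
        ; *-cong     = *-cong
        ; *-assoc    = λ x y z → pointwise λ n →
            ℚ.*-assoc (seq x n) (seq y n) (seq z n)
        ; *-identity = (λ x → pointwise λ n → ℚ.*-identityˡ (seq x n))
                     , (λ x → pointwise λ n → ℚ.*-identityʳ (seq x n))
        ; distrib    = (λ x y z → pointwise λ n →
                          ℚ.*-distribˡ-+ (seq x n) (seq y n) (seq z n))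
                     , (λ x y z → pointwise λ n →
                          ℚ.*-distribʳ-+ (seq x n) (seq y n) (seq z n))
        }
      ; *-comm = λ x y → pointwise λ n → ℚ.*-comm (seq x n) (seq y n)
      }
    }

open Real public using (ℝ; fromℚ; ℝ-commutativeRing)

module LinearAlgebra {c ℓ} (R : CommutativeRing c ℓ) where

  open CommutativeRing R
  open RawMonoidSum +-rawMonoid public using (sum)

  SquareMatrix : ℕ → Set c
  SquareMatrix n = Fin n → Fin n → Carrier

  infix 4 _≋_
  _≋_ : ∀ {n} → Rel (Vector Carrier n) ℓ
  u ≋ v = ∀ i → u i ≈ v i

  infixr 7 _·_ _∙_
  _·_ : ∀ {n} → SquareMatrix n → Vector Carrier n → Vector Carrier n
  (A · v) i = sum λ j → A i j * v j

  _∙_ : ∀ {n} → Carrier → Vector Carrier n → Vector Carrier n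
  (λ′ ∙ v) i = λ′ * v i

  combination : ∀ {m n} → Vector Carrier m → Vector (Vector Carrier n) m →
                Vector Carrier n
  combination a b i = sum λ k → a k * b k i

  LinearlyIndependent : ∀ {m n} → Vector (Vector Carrier n) m → Set (c ⊔ ℓ)
  LinearlyIndependent b =
    ∀ a → combination a b ≋ (λ _ → 0#) → ∀ k → a k ≈ 0#

  InEigenspace : ∀ {n} → SquareMatrix n → Carrier → Vector Carrier n → Set ℓ
  InEigenspace A λ′ v = A · v ≋ λ′ ∙ v

  record IsEigenspaceBasis {m n} (A : SquareMatrix n) (λ′ : Carrier)
                           (b : Vector (Vector Carrier n) m) : Set (c ⊔ ℓ) where
    field
      inEigenspace        : ∀ k → InEigenspace A λ′ (b k)
      linearlyIndependent : LinearlyIndependent b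
      spanning            : ∀ v → InEigenspace A λ′ v → ∃[ a ] v ≋ combination a b

  -- λ′ occurs exactly m times in the multiset of eigenvalues of A, where
  -- each eigenvalue is counted as often as the dimension of its eigenspace
  -- (for real symmetric matrices this is also its multiplicity as a root of
  -- the characteristic polynomial).  m = 0 says that λ′ is not an eigenvalue.
  HasMultiplicity : ∀ {n} → SquareMatrix n → Carrier → ℕ → Set (c ⊔ ℓ)
  HasMultiplicity {n} A λ′ m =
    ∃[ b ] IsEigenspaceBasis {m} {n} A λ′ b

record Graph : Set₁ where
  field
    order    : ℕ
    _~_      : Rel (Fin order) 0ℓ
    _~?_     : Decidable _~_
    ~-sym    : Symmetric _~_
    ~-irrefl : Irreflexive _≡_ _~_

  Vertex : Set
  Vertex = Fin order

  degree : Vertex → ℕ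
  degree u = length (filter (u ~?_) (allFin order))

open LinearAlgebra ℝ-commutativeRing using (SquareMatrix; HasMultiplicity)

adjacencyMatrix : (G : Graph) → SquareMatrix (Graph.order G)
adjacencyMatrix G u v = if does (u ~? v) then fromℚ 1ℚ else fromℚ 0ℚ
  where open Graph G

-- The two multisets of eigenvalues agree: every real number has the same
-- multiplicity in both.
SameSpectrum : Graph → Graph → Set
SameSpectrum G H = ∀ (x : ℝ) m →
  HasMultiplicity (adjacencyMatrix G) x m ⇔ HasMultiplicity (adjacencyMatrix H) x m

infixr 5 _∪_

_∪_ : Graph → Graph → Graph
G ∪ H = record
  { order    = order G ℕ.+ order H
  ; _~_      = λ u v → Pointwise (_~_ G) (_~_ H) (split u) (split v)
  ; _~?_     = λ u v → Sum.⊎-decidable (_~?_ G) (_~?_ H) (split u) (split v)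
  ; ~-sym    = Sum.⊎-symmetric (~-sym G) (~-sym H)
  ; ~-irrefl = λ { {u} refl → irrefl (split u) }
  }
  where
  open Graph
  split : Fin (order G ℕ.+ order H) → Fin (order G) ⊎ Fin (order H)
  split = splitAt (order G)

  irrefl : ∀ s → ¬ Pointwise (_~_ G) (_~_ H) s s
  irrefl (inj₁ _) (inj₁ p) = ~-irrefl G refl p
  irrefl (inj₂ _) (inj₂ p) = ~-irrefl H refl p

P : ℕ → Graph
P n = record
  { order    = n
  ; _~_      = λ u v → toℕ v ≡ suc (toℕ u) ⊎ toℕ u ≡ suc (toℕ v)
  ; _~?_     = λ u v → (toℕ v ℕ.≟ suc (toℕ u)) ⊎-dec (toℕ u ℕ.≟ suc (toℕ v))
  ; ~-sym    = Sum.swap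
  ; ~-irrefl = λ { refl → Sum.[ irrefl , irrefl ] }
  }
  where
  irrefl : ∀ {i} → ¬ i ≡ suc i
  irrefl ()

-- The cyclic successor i ↦ i + 1 (mod k).
next : ∀ {k} → Fin k → Fin k
next {suc n} i = suc (toℕ i) mod suc n

next≢ : ∀ {k} → 2 ℕ.≤ k → (i : Fin k) → next i ≢ i
next≢ {suc n} (s≤s 1≤n) i eq = case ℕ.m≤n⇒m<n∨m≡n (Fin.toℕ<n i) of λ
  { (inj₁ lt)   → ℕ.1+n≢n (trans (sym (m<n⇒m%n≡m lt)) eq′)
  ; (inj₂ i≡n) → ℕ.<⇒≢ 1≤n (trans (sym (n%n≡0 (suc n)))
      (trans (cong (_% suc n) (sym i≡n)) (trans eq′ (ℕ.suc-injective i≡n))))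
  }
  where
  eq′ : suc (toℕ i) % suc n ≡ toℕ i
  eq′ = trans (sym (Fin.toℕ-fromℕ< (m%n<n (suc (toℕ i)) (suc n)))) (cong toℕ eq)

C : (k : ℕ) {3≤k : True (3 ℕ.≤? k)} → Graph
C k {3≤k} = record
  { order    = k
  ; _~_      = λ u v → v ≡ next u ⊎ u ≡ next v
  ; _~?_     = λ u v → (v Fin.≟ next u) ⊎-dec (u Fin.≟ next v)
  ; ~-sym    = Sum.swap
  ; ~-irrefl = λ { {u} refl → Sum.[ irrefl u , irrefl u ] }
  }
  where
  irrefl : ∀ u → u ≢ next u
  irrefl u eq = next≢ (ℕ.≤-trans (s≤s (s≤s z≤n)) (toWitness 3≤k)) u (sym eq)

record Cycle (G : Graph) (k : ℕ) : Set where
  open Graph G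
  field
    3≤k       : 3 ℕ.≤ k
    at        : Fin k → Vertex
    injective : Injective _≡_ _≡_ at
    adjacent  : ∀ i → at i ~ at (next i)

  HasEdge : Rel Vertex 0ℓ
  HasEdge u v = ∃[ i ] (u ≡ at i × v ≡ at (next i) ⊎ u ≡ at (next i) × v ≡ at i)

-- Traversals that differ in starting point or direction are the same cycle:
-- cycles are identified when they have the same edges.
cycleSetoid : Graph → ℕ → Setoid 0ℓ 0ℓ
cycleSetoid G k = record
  { Carrier       = Cycle G k
  ; _≈_           = λ c d → ∀ u v → HasEdge c u v ⇔ HasEdge d u v
  ; isEquivalence = record
    { refl  = λ u v → ⇔-id _
    ; sym   = λ p u v → ⇔-sym (p u v)
    ; trans = λ p q u v → q u v ⇔-∘ p u v
    }
  }
  where open Cycle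

-- G has exactly N subgraphs isomorphic to the cycle of length k.
HasCycleCount : Graph → (k : ℕ) → ℕ → Set
HasCycleCount G k N = Inverse (cycleSetoid G k) (setoid (Fin N))

HasGirth : Graph → ℕ → Set
HasGirth G g = Cycle G g × (∀ k → Cycle G k → g ℕ.≤ k)

record Bipartition (G : Graph) : Set where
  open Graph G
  field
    side   : Vertex → Bool
    proper : ∀ {u v} → u ~ v → side u ≢ side v

  sideVertices : Bool → List Vertex
  sideVertices s = filter (λ v → side v Bool.≟ s) (allFin order)

  degreeSequence : Bool → List ℕ
  degreeSequence s = sort (map degree (sideVertices s))
    where open Sort (Flip.decTotalOrder ℕ.≤-decTotalOrder) using (sort)

Bipartite : Graph → Set
Bipartite = Bipartition

-- Sides are matched by their Bool label; matching them the other way round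
-- amounts to negating one of the two bipartitions.
SameDegreeSequences : Graph → Graph → Set
SameDegreeSequences G H =
  Σ (Bipartition G) λ p → Σ (Bipartition H) λ q →
    ∀ s → Bipartition.degreeSequence p s ≡ Bipartition.degreeSequence q s

-- A disconnected graph can have several bipartitions, and any one of them may
-- witness bi-regularity, so Irregular excludes all of them.
BiRegular : Graph → Set
BiRegular G = Σ (Bipartition G) λ p → let open Bipartition p in
  ∀ u v → side u ≡ side v → degree u ≡ degree v
  where open Graph G

Irregular : Graph → Set
Irregular G = ¬ BiRegular G

record IsExample (G H : Graph) : Set where
  field
    bipartite₁          : Bipartite G
    bipartite₂          : Bipartite H
    irregular₁          : Irregular G
    irregular₂          : Irregular H
    sameSpectrum        : SameSpectrum G H
    sameDegreeSequences : SameDegreeSequences G H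
    girth₁              : HasGirth G 6
    girth₂              : HasGirth H 6
    differentCounts     : ∃[ M ] ∃[ N ]
      HasCycleCount G 6 M × HasCycleCount H 6 N × M ≢ N

{-# OPTIONS --safe #-}

-- Odd functions on ℤ/2n which vanish at 0 and n are functions on P (n - 1), and
-- extending a function oddly commutes with the adjacency operators.  Doing this
-- about 0 and about -1 gives two copies of the space of P (n - 1) in that of
-- C (2n), complementary to the functions that only depend on the parity of the
-- vertex.  Hence C 6 is the sum of two copies of P 2 and a two-dimensional part
-- common to all even cycles, C 14 the sum of two copies of P 6 and that part, and
-- the two adjacency matrices are similar over ℚ.  Similar matrices have
-- isomorphic eigenspaces, so no eigenvalue has to be computed.  The cycles of
-- length at most 6 are found by exhausting the walks of that length.

module Submission where

open import Algebra.Bundles using (CommutativeRing)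
import Algebra.Properties.Semiring.Sum as BigSum
open import Data.Bool.Base using (Bool; true; false; not; if_then_else_; _∨_)
import Data.Bool.Properties as Bool
open import Data.Empty using (⊥; ⊥-elim)
open import Data.Fin.Base using (Fin; zero; suc; toℕ; inject₁; splitAt; _↑ˡ_; _↑ʳ_)
open import Data.Fin.Patterns using (0F; 1F)
import Data.Fin.Properties as Fin
open import Data.Integer.Base as ℤ using (ℤ; +_; 0ℤ; 1ℤ; -1ℤ)
import Data.Integer.Properties as ℤ
open import Data.List.Base using (partition; _++_)
open import Data.List.Relation.Binary.Permutation.Propositional
  using (_↭_; ↭-sym; ↭-trans; ↭-reflexive; ↭⇒↭ₛ; ↭ₛ⇒↭)
import Data.List.Relation.Binary.Permutation.Setoid.Properties as Permutation
open import Data.List.Relation.Binary.Pointwise using (Pointwise-≡⇒≡)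
open import Data.List.Relation.Unary.Sorted.TotalOrder.Properties using (↗↭↗⇒≋)
import Data.List.Sort as Sort
open import Data.Nat.Base as ℕ using (ℕ; zero; suc; s≤s; _≡ᵇ_; _≤ᵇ_; _%_)
open import Data.Nat.DivMod using (m<n⇒m%n≡m; m%n<n)
import Data.Nat.Properties as ℕ
open import Data.Product.Base using (∃₂; ∃-syntax; _×_; _,_; proj₁; proj₂; swap; uncurry)
open import Data.Rational.Base as ℚ using ()
open import Data.Rational.Literals using (fromℤ)
import Data.Rational.Properties as ℚ
open import Data.Rational.Unnormalised.Base using (*≡*)
import Data.Rational.Unnormalised.Properties as ℚᵘ
open import Data.Sum.Base as Sum using (_⊎_; inj₁; inj₂)
import Data.Sum.Relation.Binary.Pointwise as Pointwise
open import Data.Vec.Base using (Vec; []; _∷_; lookup; tabulate)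
open import Data.Vec.Functional using (Vector)
open import Data.Vec.Properties using (lookup∘tabulate)
open import Defs
open import Function.Base using (_∘_)
open import Function.Bundles using (mk⇔; Equivalence)
open import Level using (_⊔_)
open import Relation.Binary.Bundles using (Setoid)
import Relation.Binary.Construct.Flip.EqAndOrd as Flip
open import Relation.Binary.PropositionalEquality
  using (_≡_; _≢_; _≗_; refl; sym; trans; cong; cong₂; subst; subst₂; setoid; module ≡-Reasoning)
import Relation.Binary.Reasoning.Setoid as SetoidReasoning
open import Relation.Nullary using (Dec; does; yes; no)
open import Relation.Nullary.Decidable
  using (True; toWitness; from-yes; ¬?; _×-dec_; _⊎-dec_; _→-dec_)
open import Relation.Unary using (Decidable)

-- Similar matrices over a commutative ring.

module Similarity {c ℓ} (R : CommutativeRing c ℓ) where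

  open CommutativeRing R hiding (zero)
    renaming (refl to ≈-refl; sym to ≈-sym; trans to ≈-trans)
  open LinearAlgebra R
  open BigSum semiring using (sum-cong-≋; ∑-comm; *-distribˡ-sum; sum-replicate-zero)
  open SetoidReasoning (CommutativeRing.setoid R)

  private variable
    m n : ℕ

  *-swap : ∀ x y z → x * (y * z) ≈ y * (x * z)
  *-swap x y z = ≈-trans (≈-sym (*-assoc x y z))
    (≈-trans (*-congʳ (*-comm x y)) (*-assoc y x z))

  ·-cong : ∀ (A : SquareMatrix n) {u v} → u ≋ v → A · u ≋ A · v
  ·-cong A u≋v i = sum-cong-≋ λ j → *-congˡ (u≋v j)

  ·-∙ : ∀ (A : SquareMatrix n) x v → A · (x ∙ v) ≋ x ∙ (A · v)
  ·-∙ A x v i = ≈-trans (sum-cong-≋ λ j → *-swap (A i j) x (v j))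
    (≈-sym (*-distribˡ-sum x λ j → A i j * v j))

  ·-0 : ∀ (A : SquareMatrix n) → A · (λ _ → 0#) ≋ (λ _ → 0#)
  ·-0 {n} A i = ≈-trans (sum-cong-≋ λ j → zeroʳ (A i j)) (sum-replicate-zero n)

  ·-combination : ∀ (A : SquareMatrix n) a (b : Vector (Vector Carrier n) m) →
                  A · combination a b ≋ combination a (λ k → A · b k)
  ·-combination A a b i = begin
    sum (λ j → A i j * sum (λ k → a k * b k j))
      ≈⟨ sum-cong-≋ (λ j → *-distribˡ-sum (A i j) λ k → a k * b k j) ⟩
    sum (λ j → sum (λ k → A i j * (a k * b k j)))
      ≈⟨ sum-cong-≋ (λ j → sum-cong-≋ λ k → *-swap (A i j) (a k) (b k j)) ⟩
    sum (λ j → sum (λ k → a k * (A i j * b k j)))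
      ≈⟨ ∑-comm (λ j k → a k * (A i j * b k j)) ⟩
    sum (λ k → sum (λ j → a k * (A i j * b k j)))
      ≈⟨ sum-cong-≋ (λ k → *-distribˡ-sum (a k) λ j → A i j * b k j) ⟨
    sum (λ k → a k * sum (λ j → A i j * b k j)) ∎

  column : SquareMatrix n → Fin n → Vector Carrier n
  column A k i = A i k

  infixr 7 _⊡_
  _⊡_ : SquareMatrix n → SquareMatrix n → SquareMatrix n
  (A ⊡ B) i k = (A · column B k) i

  scalar : Carrier → SquareMatrix n
  scalar x i j = if does (i Fin.≟ j) then x else 0#

  ·-columns : ∀ (A : SquareMatrix n) v → A · v ≋ combination v (column A)
  ·-columns A v i = sum-cong-≋ λ j → *-comm (A i j) (v j)

  -- A product with a vector is a combination of columns, so this is linearity of `A` applied to the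
  -- columns of `B`.
  ⊡-· : ∀ (A B : SquareMatrix n) v → A · (B · v) ≋ (A ⊡ B) · v
  ⊡-· A B v i = begin
    (A · (B · v)) i                         ≈⟨ ·-cong A (·-columns B v) i ⟩
    (A · combination v (column B)) i        ≈⟨ ·-combination A v (column B) i ⟩
    combination v (λ k → A · column B k) i  ≈⟨ ·-columns (A ⊡ B) v i ⟨
    ((A ⊡ B) · v) i                         ∎

  matrix-cong : ∀ {A B : SquareMatrix n} → (∀ i j → A i j ≈ B i j) → ∀ v → A · v ≋ B · v
  matrix-cong A≈B v i = sum-cong-≋ λ j → *-congʳ (A≈B i j)

  scalar-· : ∀ x (v : Vector Carrier n) → scalar x · v ≋ x ∙ v
  scalar-· {suc n} x v zero = ≈-trans
    (+-congˡ (≈-trans (sum-cong-≋ {n} λ j → zeroˡ (v (suc j))) (sum-replicate-zero n)))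
    (+-identityʳ _)
  scalar-· {suc n} x v (suc i) = ≈-trans
    (≈-trans (+-congʳ (zeroˡ (v zero))) (+-identityˡ _)) (scalar-· x (v ∘ suc) i)

  record Similar (A B : SquareMatrix n) : Set (c ⊔ ℓ) where
    field
      S T         : SquareMatrix n
      inverseˡ    : ∀ v → T · (S · v) ≋ v
      inverseʳ    : ∀ v → S · (T · v) ≋ v
      intertwines : ∀ v → S · (A · v) ≋ B · (S · v)

  Similar-sym : {A B : SquareMatrix n} → Similar A B → Similar B A
  Similar-sym {A = A} {B} A∼B = record
    { S           = T
    ; T           = S
    ; inverseˡ    = inverseʳ
    ; inverseʳ    = inverseˡ
    ; intertwines = λ v i → begin
        (T · (B · v)) i              ≈⟨ ·-cong T (·-cong B (inverseʳ v)) i ⟨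
        (T · (B · (S · (T · v)))) i  ≈⟨ ·-cong T (intertwines (T · v)) i ⟨
        (T · (S · (A · (T · v)))) i  ≈⟨ inverseˡ (A · (T · v)) i ⟩
        (A · (T · v)) i              ∎
    }
    where open Similar A∼B

  -- `S` maps the given basis to the new one. `T` carries linear relations and eigenvectors of `B`
  -- back to `A`, where independence and spanning are known.
  Similar⇒HasMultiplicity : ∀ {A B : SquareMatrix n} → Similar A B →
    ∀ {x} → HasMultiplicity A x m → HasMultiplicity B x m
  Similar⇒HasMultiplicity {A = A} {B} A∼B {x} (b , isBasis) = (λ k → S · b k) , record
    { inEigenspace        = λ k i → begin
        (B · (S · b k)) i  ≈⟨ intertwines (b k) i ⟨
        (S · (A · b k)) i  ≈⟨ ·-cong S (inEigenspace k) i ⟩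
        (S · (x ∙ b k)) i  ≈⟨ ·-∙ S x (b k) i ⟩
        (x ∙ (S · b k)) i  ∎
    ; linearlyIndependent = λ a Sab≋0 → linearlyIndependent a λ i → begin
        combination a b i                            ≈⟨ inverseˡ (combination a b) i ⟨
        (T · (S · combination a b)) i                ≈⟨ ·-cong T (·-combination S a b) i ⟩
        (T · combination a (λ k → S · b k)) i        ≈⟨ ·-cong T Sab≋0 i ⟩
        (T · (λ _ → 0#)) i                           ≈⟨ ·-0 T i ⟩
        0#                                           ∎
    ; spanning            = λ v Bv≋xv →
        let a , Tv≋ab = spanning (T · v) λ i → begin
              (A · (T · v)) i  ≈⟨ Similar.intertwines (Similar-sym A∼B) v i ⟨
              (T · (B · v)) i  ≈⟨ ·-cong T Bv≋xv i ⟩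
              (T · (x ∙ v)) i  ≈⟨ ·-∙ T x v i ⟩
              (x ∙ (T · v)) i  ∎
        in a , λ i → begin
          v i                            ≈⟨ inverseʳ v i ⟨
          (S · (T · v)) i                ≈⟨ ·-cong S Tv≋ab i ⟩
          (S · combination a b) i        ≈⟨ ·-combination S a b i ⟩
          combination a (λ k → S · b k) i ∎
    }
    where
    open Similar A∼B
    open IsEigenspaceBasis isBasis

-- Passage from integer matrices to real ones.

open LinearAlgebra ℝ-commutativeRing using (SquareMatrix; _·_; _∙_; _≋_; sum)
open Similarity ℝ-commutativeRing
open LinearAlgebra ℤ.+-*-commutativeRing using () renaming
  (SquareMatrix to ℤMatrix; sum to sumℤ)
open Similarity ℤ.+-*-commutativeRing using () renaming (_⊡_ to _⊡ℤ_; scalar to scalarℤ)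

module R = CommutativeRing ℝ-commutativeRing
open R using () renaming (_≈_ to _≃_; _+_ to _+ᴿ_; _*_ to _*ᴿ_)

pointwise⇒≃ : ∀ {x y : ℝ} → (∀ n → Real.ℝ.seq x n ≡ Real.ℝ.seq y n) → x ≃ y
pointwise⇒≃ {x} {y} eq = Real.equal λ ε 0<ε → 0 , λ n _ → subst (ℚ._< ε)
  (sym (cong ℚ.∣_∣ (trans (cong (ℚ._- Real.ℝ.seq y n) (eq n)) (ℚ.+-inverseʳ (Real.ℝ.seq y n))))) 0<ε

fromℤ-homo-+ : ∀ a b → fromℤ (a ℤ.+ b) ≡ fromℤ a ℚ.+ fromℤ b
fromℤ-homo-+ a b = ℚ.toℚᵘ-injective (ℚᵘ.≃-trans
  -- Over the denominator 1 the unnormalised sum has numerator `a * 1 + b * 1`.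
  (*≡* (cong (ℤ._* 1ℤ) (cong₂ ℤ._+_ (sym (ℤ.*-identityʳ a)) (sym (ℤ.*-identityʳ b)))))
  (ℚᵘ.≃-sym (ℚ.toℚᵘ-homo-+ (fromℤ a) (fromℤ b))))

fromℤ-homo-* : ∀ a b → fromℤ (a ℤ.* b) ≡ fromℤ a ℚ.* fromℤ b
fromℤ-homo-* a b = ℚ.toℚᵘ-injective (ℚᵘ.≃-sym (ℚ.toℚᵘ-homo-* (fromℤ a) (fromℤ b)))

ι : ℤ → ℝ
ι z = fromℚ (fromℤ z)

ι-+ : ∀ a b → ι (a ℤ.+ b) ≃ ι a +ᴿ ι b
ι-+ a b = pointwise⇒≃ λ _ → fromℤ-homo-+ a b

ι-* : ∀ a b → ι (a ℤ.* b) ≃ ι a *ᴿ ι b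
ι-* a b = pointwise⇒≃ λ _ → fromℤ-homo-* a b

ι-sum : ∀ {n} (u : Vector ℤ n) → ι (sumℤ u) ≃ sum (ι ∘ u)
ι-sum {zero}  u = R.refl
ι-sum {suc n} u = R.trans (ι-+ (u zero) _) (R.+-congˡ (ι-sum (u ∘ suc)))

embed : ∀ {n} → ℤMatrix n → SquareMatrix n
embed A i j = ι (A i j)

embed-⊡ : ∀ {n} (A B : ℤMatrix n) i j → embed (A ⊡ℤ B) i j ≃ (embed A ⊡ embed B) i j
embed-⊡ A B i k = R.trans (ι-sum λ j → A i j ℤ.* B j k)
  (BigSum.sum-cong-≋ R.semiring λ j → ι-* (A i j) (B j k))

embed-scalar : ∀ {n} x i j → embed {n} (scalarℤ x) i j ≡ scalar (ι x) i j
embed-scalar x i j = Bool.if-float ι (does (i Fin.≟ j))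

-- Integer entries keep the three identities decidable by evaluation, so `T` is the inverse cleared
-- of denominators. Writing the scale as `suc d` makes it invertible in `ℚ`.
record SimilarUpToScale {n} (A B : ℤMatrix n) : Set where
  field
    S T         : ℤMatrix n
    d           : ℕ
    inverseˡ    : ∀ i j → (T ⊡ℤ S) i j ≡ scalarℤ (+ suc d) i j
    inverseʳ    : ∀ i j → (S ⊡ℤ T) i j ≡ scalarℤ (+ suc d) i j
    intertwines : ∀ i j → (S ⊡ℤ A) i j ≡ (B ⊡ℤ S) i j

embed-⊡-cong : ∀ {n} (A B M N : ℤMatrix n) → (∀ i j → (A ⊡ℤ B) i j ≡ (M ⊡ℤ N) i j) →
             ∀ v → embed A · (embed B · v) ≋ embed M · (embed N · v)
embed-⊡-cong A B M N AB≡MN v i = R.trans (⊡-· (embed A) (embed B) v i) (R.trans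
  (matrix-cong (λ j k → R.trans (R.sym (embed-⊡ A B j k))
    (R.trans (R.reflexive (cong ι (AB≡MN j k))) (embed-⊡ M N j k))) v i)
  (R.sym (⊡-· (embed M) (embed N) v i)))

embed-⊡-scalar : ∀ {n} (A B : ℤMatrix n) x → (∀ i j → (A ⊡ℤ B) i j ≡ scalarℤ x i j) →
               ∀ v → embed A · (embed B · v) ≋ ι x ∙ v
embed-⊡-scalar A B x AB≡x v i = R.trans (⊡-· (embed A) (embed B) v i) (R.trans
  (matrix-cong (λ j k → R.trans (R.sym (embed-⊡ A B j k))
    (R.reflexive (trans (cong ι (AB≡x j k)) (embed-scalar x j k)))) v i)
  (scalar-· (ι x) v i))

SimilarUpToScale⇒Similar : ∀ {n} {A B : ℤMatrix n} → SimilarUpToScale A B → Similar (embed A) (embed B)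
SimilarUpToScale⇒Similar {n} {A} {B} A∼B = record
  { S           = embed S
  ; T           = λ i j → e *ᴿ embed T i j
  ; inverseˡ    = λ v i → R.trans (scaled (embed S · v) i) (cancel (embed T · (embed S · v)) v
                    (embed-⊡-scalar T S (+ suc d) inverseˡ v) i)
  ; inverseʳ    = λ v i → R.trans (·-cong (embed S) (scaled v) i)
                    (R.trans (·-∙ (embed S) e (embed T · v) i)
                    (cancel (embed S · (embed T · v)) v
                      (embed-⊡-scalar S T (+ suc d) inverseʳ v) i))
  ; intertwines = embed-⊡-cong S A B S intertwines
  }
  where
  open SimilarUpToScale A∼B

  e : ℝ
  e = fromℚ (ℚ.1/ fromℤ (+ suc d))

  scaled : ∀ v → (λ i j → e *ᴿ embed T i j) · v ≋ e ∙ (embed T · v)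
  scaled v i = R.trans
    (BigSum.sum-cong-≋ R.semiring λ j → R.*-assoc e (embed T i j) (v j))
    (R.sym (BigSum.*-distribˡ-sum R.semiring e λ j → embed T i j *ᴿ v j))

  cancel : ∀ (u v : Vector ℝ n) → u ≋ ι (+ suc d) ∙ v → e ∙ u ≋ v
  cancel u v u≋dv i = R.trans (R.*-congˡ (u≋dv i)) (R.trans
    (R.sym (R.*-assoc e (ι (+ suc d)) (v i)))
    (R.trans (R.*-congʳ (pointwise⇒≃ λ _ → ℚ.*-inverseˡ (fromℤ (+ suc d))))
      (R.*-identityˡ (v i))))

-- The integer similarity of the two adjacency matrices.

adjacencyℤ : (G : Graph) → ℤMatrix (Graph.order G)
adjacencyℤ G u v = if does (Graph._~?_ G u v) then 1ℤ else 0ℤ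

G₁ G₂ : Graph
G₁ = C 6 ∪ C 6 ∪ P 6 ∪ P 6
G₂ = C 6 ∪ C 14 ∪ P 2 ∪ P 2

module Decomposition {2n n-1 : ℕ} where

  -- Vertex a of P (n - 1) stands for the vertex a + 1 of C (2n).
  odd odd′ : Fin 2n → Fin n-1 → ℤ
  odd i a = if toℕ i ≡ᵇ suc (toℕ a) then 1ℤ else
            if toℕ i ℕ.+ suc (toℕ a) ≡ᵇ 2n then -1ℤ else 0ℤ
  odd′ i a = odd (next i) a

  -- If f j = v j + w (j + 1) with v and w odd, then, for a vertex a of C (2n), w a
  -- is the sum of f j and - v a that of f (j - 1) over all |j| < a with j ≢ a mod 2,
  -- as the other terms cancel.  The entries are scaled by 2n, and subtracting 2a
  -- makes the result zero when f depends on parity only.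
  window : Fin 2n → Fin n-1 → ℤ
  window i a = if (toℕ i ℕ.+ toℕ a) % 2 ≡ᵇ 0
    then (if (toℕ i ≤ᵇ toℕ a) ∨ (2n ≤ᵇ toℕ i ℕ.+ toℕ a) then + 2n else 0ℤ)
           ℤ.- + (2 ℕ.* suc (toℕ a))
    else 0ℤ

  -- The window sums give `- v a` from the values `f (j - 1)`: a vertex `i` enters as `j = i + 1`,
  -- whence `next` and the sign.
  coefficient coefficient′ : Fin 2n → Fin n-1 → ℤ
  coefficient i a = ℤ.- window (next i) a
  coefficient′ = window

open Decomposition

parity : ∀ {m n} → Fin m → Fin n → ℤ
parity i j = if toℕ i % 2 ≡ᵇ toℕ j % 2 then 1ℤ else 0ℤ

split : ∀ a b c {d} → Fin (a ℕ.+ (b ℕ.+ (c ℕ.+ d))) → Fin a ⊎ Fin b ⊎ Fin c ⊎ Fin d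
split a b c = Sum.map₂ (Sum.map₂ (splitAt c) ∘ splitAt b) ∘ splitAt a

pattern in₀ i = inj₁ i
pattern in₁ i = inj₂ (inj₁ i)
pattern in₂ i = inj₂ (inj₂ (inj₁ i))
pattern in₃ i = inj₂ (inj₂ (inj₂ i))

Parts₁ Parts₂ : Set
Parts₁ = Fin 6 ⊎ Fin 6 ⊎ Fin 6 ⊎ Fin 6
Parts₂ = Fin 6 ⊎ Fin 14 ⊎ Fin 2 ⊎ Fin 2

-- The odd parts of a function on C 6 go to the two copies of P 2, its sums over the
-- parity classes and the odd extensions of the functions on P 6 to C 14.
forth : Parts₂ → Parts₁ → ℤ
forth (in₀ i) (in₀ j) = scalarℤ 1ℤ i j
forth (in₁ i) (in₁ j) = parity i j
forth (in₁ i) (in₂ a) = odd i a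
forth (in₁ i) (in₃ a) = odd′ i a
forth (in₂ a) (in₁ j) = odd j a
forth (in₃ a) (in₁ j) = odd′ j a
forth _       _       = 0ℤ

-- 42 times the inverse of forth, where 42 = 7 * 6 = 3 * 14 clears the factors 2n.
back : Parts₁ → Parts₂ → ℤ
back (in₀ i) (in₀ j) = scalarℤ (+ 42) i j
back (in₁ i) (in₁ j) = + 2 ℤ.* parity i j
back (in₁ i) (in₂ a) = + 7 ℤ.* coefficient i a
back (in₁ i) (in₃ a) = + 7 ℤ.* coefficient′ i a
back (in₂ a) (in₁ j) = + 3 ℤ.* coefficient j a
back (in₃ a) (in₁ j) = + 3 ℤ.* coefficient′ j a
back _       _       = 0ℤ

equalMatrices? : ∀ {n} (A B : ℤMatrix n) → Dec (∀ i j → A i j ≡ B i j)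
equalMatrices? A B = Fin.all? λ i → Fin.all? λ j → A i j ℤ.≟ B i j

-- `odd` and `odd′` intertwine path and cycle; the adjacency matrices being symmetric, so do their
-- transposes in the opposite direction, which are used from `C 6` to `P 2`. Following `parity` by
-- its transpose and by `parity` again multiplies it by 3 * 7 = 21, whence the factor 2 in `back`.
similarGraphs : SimilarUpToScale (adjacencyℤ G₁) (adjacencyℤ G₂)
similarGraphs = record
  { S           = S
  ; T           = T
  ; d           = 41
  ; inverseˡ    = from-yes (equalMatrices? (T ⊡ℤ S) (scalarℤ (+ 42)))
  ; inverseʳ    = from-yes (equalMatrices? (S ⊡ℤ T) (scalarℤ (+ 42)))
  ; intertwines = from-yes (equalMatrices? (S ⊡ℤ adjacencyℤ G₁) (adjacencyℤ G₂ ⊡ℤ S))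
  }
  where
  S T : ℤMatrix 24
  S i j = forth (split 6 14 2 i) (split 6 6 6 j)
  T i j = back (split 6 6 6 i) (split 6 14 2 j)

-- Equality of the spectra.

Similar-cong : ∀ {n} {A A′ B B′ : SquareMatrix n} → (∀ i j → A i j ≃ A′ i j) →
  (∀ i j → B i j ≃ B′ i j) → Similar A B → Similar A′ B′
Similar-cong A≃A′ B≃B′ A∼B = record
  { S           = S
  ; T           = T
  ; inverseˡ    = inverseˡ
  ; inverseʳ    = inverseʳ
  ; intertwines = λ v i → R.trans
      (·-cong S (matrix-cong (λ j k → R.sym (A≃A′ j k)) v) i)
      (R.trans (intertwines v i) (matrix-cong B≃B′ (S · v) i))
  }
  where open Similar A∼B

adjacencyMatrix≃embed : ∀ G u v → embed (adjacencyℤ G) u v ≃ adjacencyMatrix G u v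
adjacencyMatrix≃embed G u v = R.reflexive (Bool.if-float ι (does (Graph._~?_ G u v)))

sameSpectrum : SameSpectrum G₁ G₂
sameSpectrum x m = mk⇔ (Similar⇒HasMultiplicity G₁∼G₂)
                       (Similar⇒HasMultiplicity (Similar-sym G₁∼G₂))
  where
  G₁∼G₂ : Similar (adjacencyMatrix G₁) (adjacencyMatrix G₂)
  G₁∼G₂ = Similar-cong (adjacencyMatrix≃embed G₁) (adjacencyMatrix≃embed G₂)
    (SimilarUpToScale⇒Similar similarGraphs)

-- Edge sets of cyclic sequences.

next-inject₁ : ∀ {k} (i : Fin k) → next (inject₁ i) ≡ suc i
next-inject₁ {k} i = Fin.toℕ-injective (begin
  toℕ (next (inject₁ i))          ≡⟨ Fin.toℕ-fromℕ< (m%n<n (suc (toℕ (inject₁ i))) (suc k)) ⟩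
  suc (toℕ (inject₁ i)) % suc k   ≡⟨ cong (λ j → suc j % suc k) (Fin.toℕ-inject₁ i) ⟩
  suc (toℕ i) % suc k             ≡⟨ m<n⇒m%n≡m (s≤s (Fin.toℕ<n i)) ⟩
  suc (toℕ i)                     ∎)
  where open ≡-Reasoning

module _ {a} {A : Set a} where

  -- This is `HasEdge` for arbitrary sequences, so that it applies to candidates not yet known to be
  -- cycles; on `at c` the two agree definitionally.
  Edge : ∀ {k} → (Fin k → A) → A → A → Set a
  Edge f u v = ∃[ i ] (u ≡ f i × v ≡ f (next i) ⊎ u ≡ f (next i) × v ≡ f i)

  infix 4 _⊆_
  _⊆_ : ∀ {k} → (Fin k → A) → (Fin k → A) → Set a
  f ⊆ g = ∀ i → Edge g (f i) (f (next i))

  ⊆-Edge : ∀ {k} {f g : Fin k → A} → f ⊆ g → ∀ {u v} → Edge f u v → Edge g u v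
  ⊆-Edge f⊆g (i , inj₁ (refl , refl)) = f⊆g i
  ⊆-Edge f⊆g (i , inj₂ (refl , refl)) with f⊆g i
  ... | j , e = j , Sum.swap (Sum.map swap swap e)

  Edge-⊆ : ∀ {k} {f g : Fin k → A} → (∀ {u v} → Edge f u v → Edge g u v) → f ⊆ g
  Edge-⊆ f⇒g i = f⇒g (i , inj₁ (refl , refl))

  ⊆-respˡ : ∀ {k} {f g h : Fin k → A} → f ≗ g → f ⊆ h → g ⊆ h
  ⊆-respˡ {h = h} f≗g f⊆h i = subst₂ (Edge h) (f≗g i) (f≗g (next i)) (f⊆h i)

  ⊆-respʳ : ∀ {k} {f g h : Fin k → A} → g ≗ h → f ⊆ g → f ⊆ h
  ⊆-respʳ {f = f} {g} {h} g≗h f⊆g i with f⊆g i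
  ... | j , e = j , Sum.map
    (λ (p , q) → trans p (g≗h j) , trans q (g≗h (next j)))
    (λ (p , q) → trans p (g≗h (next j)) , trans q (g≗h j)) e

  module _ (_≟_ : ∀ (x y : A) → Dec (x ≡ y)) where

    _⊆?_ : ∀ {k} (f g : Fin k → A) → Dec (f ⊆ g)
    f ⊆? g = Fin.all? λ i → Fin.any? λ j →
      ((f i ≟ g j) ×-dec (f (next i) ≟ g (next j))) ⊎-dec
      ((f i ≟ g (next j)) ×-dec (f (next i) ≟ g j))

-- Exhaustive enumeration of cycles.

module Cycles (G : Graph) where

  open Graph G
  open Cycle using (at)

  IsCycle : ∀ {k} → (Fin k → Vertex) → Set
  IsCycle f = (∀ i j → f i ≡ f j → i ≡ j) × (∀ i → f i ~ f (next i))

  isCycle? : ∀ {k} (f : Fin k → Vertex) → Dec (IsCycle f)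
  isCycle? f = (Fin.all? λ i → Fin.all? λ j → (f i Fin.≟ f j) →-dec (i Fin.≟ j))
         ×-dec (Fin.all? λ i → f i ~? f (next i))

  cycle : ∀ {k} (f : Fin k → Vertex) {3≤k : True (3 ℕ.≤? k)} {isCycle : True (isCycle? f)} →
          Cycle G k
  cycle f {3≤k} {isCycle} = record
    { 3≤k       = toWitness 3≤k
    ; at        = f
    ; injective = λ {i} {j} → proj₁ (toWitness isCycle) i j
    ; adjacent  = proj₂ (toWitness isCycle)
    }

  -- The adjacency premise stands between the quantifiers, so the search in `allWalks?` continues
  -- only along edges instead of ranging over all tuples of vertices.
  AllWalks : ∀ k → Vertex → (Vec Vertex k → Set) → Set
  AllWalks zero    u Q = Q []
  AllWalks (suc k) u Q = ∀ v → u ~ v → AllWalks k v (Q ∘ (v ∷_))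

  allWalks? : ∀ k u {Q : Vec Vertex k → Set} → (∀ w → Dec (Q w)) → Dec (AllWalks k u Q)
  allWalks? zero    u Q? = Q? []
  allWalks? (suc k) u Q? = Fin.all? λ v → (u ~? v) →-dec allWalks? k v (Q? ∘ (v ∷_))

  allWalks-tabulate : ∀ {k} (f : Fin (suc k) → Vertex) {Q : Vec Vertex k → Set} →
    (∀ i → f (inject₁ i) ~ f (suc i)) → AllWalks k (f zero) Q → Q (tabulate (f ∘ suc))
  allWalks-tabulate {zero}  f adj all = all
  allWalks-tabulate {suc k} f adj all =
    allWalks-tabulate (f ∘ suc) (adj ∘ suc) (all (f 1F) (adj 0F))

  Listed : ∀ {k N} → (Fin N → Cycle G k) → (Fin k → Vertex) → Set
  Listed cs f = ∃[ t ] (f ⊆ at (cs t) × at (cs t) ⊆ f)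

  -- A walk of `k` steps has the `suc k` vertices of a cycle; its closing edge and the distinctness
  -- of its vertices are left to `IsCycle`.
  Exhaustive : ∀ {k N} → (Fin N → Cycle G (suc k)) → Set
  Exhaustive {k} cs = ∀ u → AllWalks k u λ w →
    IsCycle (lookup (u ∷ w)) → Listed cs (lookup (u ∷ w))

  exhaustive? : ∀ {k N} (cs : Fin N → Cycle G (suc k)) → Dec (Exhaustive cs)
  exhaustive? {k} cs = Fin.all? λ u → allWalks? k u λ w →
    isCycle? (lookup (u ∷ w)) →-dec Fin.any? λ t →
      (_⊆?_ Fin._≟_ (lookup (u ∷ w)) (at (cs t))) ×-dec
      (_⊆?_ Fin._≟_ (at (cs t)) (lookup (u ∷ w)))

  exhaustive⇒listed : ∀ {k N} (cs : Fin N → Cycle G (suc k)) → Exhaustive cs →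
                      ∀ (c : Cycle G (suc k)) → Listed cs (at c)
  exhaustive⇒listed cs ex c =
    -- `lookup` of the tabulated `f` agrees with `f` only pointwise, so the cycle laws and both
    -- inclusions are transported along `same`.
    let t , c⊆t , t⊆c = allWalks-tabulate f
          -- Only the last index wraps around, so from `inject₁ i` the cyclic successor is a step of
          -- the walk.
          (λ i → subst (λ j → f (inject₁ i) ~ f j) (next-inject₁ i) (adjacent (inject₁ i)))
          (ex (f zero))
          ( (λ i j eq → injective (trans (sym (same i)) (trans eq (same j))))
          , (λ i → subst₂ _~_ (sym (same i)) (sym (same (next i))) (adjacent i)))
    in t , ⊆-respˡ same c⊆t , ⊆-respʳ same t⊆c
    where
    open Cycle {G} c using (adjacent; injective) renaming (at to f)
    same = lookup∘tabulate f

  -- Cycles of equal length have equally many edges, so one inclusion already forces equal edge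
  -- sets; this is the form that `index-unique` uses.
  Distinct : ∀ {k N} → (Fin N → Cycle G k) → Set
  Distinct cs = ∀ s t → at (cs s) ⊆ at (cs t) → s ≡ t

  distinct? : ∀ {k N} (cs : Fin N → Cycle G k) → Dec (Distinct cs)
  distinct? cs = Fin.all? λ s → Fin.all? λ t →
    (_⊆?_ Fin._≟_ (at (cs s)) (at (cs t))) →-dec (s Fin.≟ t)

  -- A cycle is sent to the position of a listed cycle with the same edges: `Exhaustive` provides
  -- one, `Distinct` makes it unique.
  cycleCount : ∀ {k N} (cs : Fin N → Cycle G (suc k)) {exhaustive : True (exhaustive? cs)}
               {distinct : True (distinct? cs)} → HasCycleCount G (suc k) N
  cycleCount {k} {N} cs {exhaustive} {distinct} = record
    { to        = index
    ; from      = cs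
    ; to-cong   = λ {c} {d} c≈d → index-unique c (index d)
                    (⊆-Edge (proj₁ (proj₂ (listed d))) ∘ Equivalence.to (c≈d _ _))
    ; from-cong = λ { {s} refl → Setoid.refl (cycleSetoid G (suc k)) {cs s} }
    ; inverse   = (λ {t} {c} c≈t → index-unique c t (Equivalence.to (c≈t _ _)))
                , (λ { {c} refl →
                    let _ , c⊆t , t⊆c = listed c
                    in λ u v → mk⇔ (⊆-Edge t⊆c) (⊆-Edge c⊆t) })
    }
    where
    listed : ∀ (c : Cycle G (suc k)) → Listed cs (at c)
    listed = exhaustive⇒listed cs (toWitness exhaustive)

    index : Cycle G (suc k) → Fin N
    index c = proj₁ (listed c)

    index-unique : ∀ c t → (∀ {u v} → Edge (at c) u v → Edge (at (cs t)) u v) → index c ≡ t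
    -- The listed representative of `c` is included in `c`, hence in `cs t`.
    index-unique c t c⇒t = toWitness distinct (index c) t
      (Edge-⊆ (c⇒t ∘ ⊆-Edge (proj₂ (proj₂ (listed c)))))

  noCycles : ∀ k → Fin 0 → Cycle G k
  noCycles k ()

  -- Exhaustiveness of the empty list says that there are no cycles of that length; lengths below 3
  -- are excluded by `3≤k`.
  girth6 : Cycle G 6 → {no₃ : True (exhaustive? (noCycles 3))}
           {no₄ : True (exhaustive? (noCycles 4))} {no₅ : True (exhaustive? (noCycles 5))} →
           HasGirth G 6
  girth6 c {no₃} {no₄} {no₅} = c , minimal
    where
    excluded : ∀ {k} → True (exhaustive? (noCycles (suc k))) → Cycle G (suc k) → ⊥
    excluded {k} none d with exhaustive⇒listed (noCycles (suc k)) (toWitness none) d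
    ... | () , _

    minimal : ∀ k → Cycle G k → 6 ℕ.≤ k
    minimal 0 d with () ← Cycle.3≤k d
    minimal 1 d with s≤s () ← Cycle.3≤k d
    minimal 2 d with s≤s (s≤s ()) ← Cycle.3≤k d
    minimal 3 d = ⊥-elim (excluded no₃ d)
    minimal 4 d = ⊥-elim (excluded no₄ d)
    minimal 5 d = ⊥-elim (excluded no₅ d)
    minimal (suc (suc (suc (suc (suc (suc k)))))) d = ℕ.m≤m+n 6 k

-- Hexagons and girth of the two graphs.

hexagons₁ : Fin 2 → Cycle G₁ 6
hexagons₁ 0F = Cycles.cycle G₁ (_↑ˡ 18)
hexagons₁ 1F = Cycles.cycle G₁ (λ i → 6 ↑ʳ (i ↑ˡ 12))

hexagons₂ : Fin 1 → Cycle G₂ 6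
hexagons₂ 0F = Cycles.cycle G₂ (_↑ˡ 18)

hexagonCount₁ : HasCycleCount G₁ 6 2
hexagonCount₁ = Cycles.cycleCount G₁ hexagons₁

hexagonCount₂ : HasCycleCount G₂ 6 1
hexagonCount₂ = Cycles.cycleCount G₂ hexagons₂

hasGirth₁ : HasGirth G₁ 6
hasGirth₁ = Cycles.girth6 G₁ (hexagons₁ 0F)

hasGirth₂ : HasGirth G₂ 6
hasGirth₂ = Cycles.girth6 G₂ (hexagons₂ 0F)

-- Irregularity, bipartitions and degree sequences.

module _ (G : Graph) where

  open Graph G

  proper? : (side : Vertex → Bool) → Dec (∀ u v → u ~ v → side u ≢ side v)
  proper? side = Fin.all? λ u → Fin.all? λ v → (u ~? v) →-dec ¬? (side u Bool.≟ side v)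

  -- An edge between `u` and `v` meets both sides of any bipartition, so under bi-regularity their
  -- common degree would be that of every vertex, and `w` has another.
  irregular : ∀ u v w → u ~ v → degree u ≡ degree v → degree w ≢ degree u → Irregular G
  irregular u v w u~v du≡dv dw≢du (p , biregular)
    with Bipartition.side p w Bool.≟ Bipartition.side p u
  ... | yes w≡u = dw≢du (biregular w u w≡u)
  ... | no  w≢u = dw≢du (trans (biregular w v (trans (Bool.¬-not w≢u) (sym v≡¬u))) (sym du≡dv))
    where
    open Bipartition p

    v≡¬u : side v ≡ not (side u)
    v≡¬u = Bool.¬-not (proper u~v ∘ sym)

-- All components of both graphs have even order, so their offsets in the disjoint union are even
-- and parity alternates along every path and around every cycle.
isEven : ∀ {n} → Fin n → Bool
isEven i = toℕ i % 2 ≡ᵇ 0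

bipartition₁ : Bipartition G₁
bipartition₁ = record
  { side = isEven ; proper = λ {u} {v} → from-yes (proper? G₁ isEven) u v }

bipartition₂ : Bipartition G₂
bipartition₂ = record
  { side = isEven ; proper = λ {u} {v} → from-yes (proper? G₂ isEven) u v }

≥-decTotalOrder = Flip.decTotalOrder ℕ.≤-decTotalOrder
open Sort ≥-decTotalOrder using (sort; sort-↭; sort-↗)

-- Two sorted permutations of one list coincide, so degree sequences can be compared without
-- evaluating `sort`.
sort-unique : ∀ {xs ys} → xs ↭ ys → sort xs ≡ sort ys
sort-unique {xs} {ys} xs↭ys = Pointwise-≡⇒≡ (↗↭↗⇒≋ (Flip.totalOrder ℕ.≤-totalOrder)
  (sort-↗ xs) (sort-↗ ys)
  (↭⇒↭ₛ (↭-trans (sort-↭ xs) (↭-trans xs↭ys (↭-sym (sort-↭ ys))))))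

partition-≡⇒↭ : ∀ {p} {P : ℕ → Set p} (P? : Decidable P) {xs ys} →
  partition P? xs ≡ partition P? ys → xs ↭ ys
partition-≡⇒↭ P? {xs} {ys} eq = ↭-trans (parts xs)
  (↭-trans (↭-reflexive (cong (uncurry _++_) eq)) (↭-sym (parts ys)))
  where
  parts : ∀ zs → zs ↭ uncurry _++_ (partition P? zs)
  parts zs = ↭ₛ⇒↭ (Permutation.partition-↭ (setoid ℕ) P? zs)

sameDegreeSequences : SameDegreeSequences G₁ G₂
sameDegreeSequences = bipartition₁ , bipartition₂ , λ
  -- On either side of each graph two degrees are 1 and ten are 2, so splitting off the 1s brings
  -- both lists to the same form.
  { false → sort-unique (partition-≡⇒↭ (ℕ._≟ 1) refl)
  ; true  → sort-unique (partition-≡⇒↭ (ℕ._≟ 1) refl)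
  }

irregular₁ : Irregular G₁
-- `18 ↑ʳ 0F` is an end of the last `P 6`, of degree 1, whereas hexagon vertices have degree 2.
irregular₁ = irregular G₁ 0F 1F (18 ↑ʳ 0F) (Pointwise.inj₁ (inj₁ refl)) refl λ ()

irregular₂ : Irregular G₂
-- `20 ↑ʳ 0F` is an end of the first `P 2`, as the two cycles take up 6 + 14 vertices.
irregular₂ = irregular G₂ 0F 1F (20 ↑ʳ 0F) (Pointwise.inj₁ (inj₁ refl)) refl λ ()

mainTheorem5 : ∃₂ IsExample × IsExample (C 6 ∪ C 6 ∪ P 6 ∪ P 6) (C 6 ∪ C 14 ∪ P 2 ∪ P 2)
mainTheorem5 = (G₁ , G₂ , example) , example
  where
  example : IsExample G₁ G₂
  example = record
    { bipartite₁          = bipartition₁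
    ; bipartite₂          = bipartition₂
    ; irregular₁          = irregular₁
    ; irregular₂          = irregular₂
    ; sameSpectrum        = sameSpectrum
    ; sameDegreeSequences = sameDegreeSequences
    ; girth₁              = hasGirth₁
    ; girth₂              = hasGirth₂
    ; differentCounts     = 2 , 1 , hexagonCount₁ , hexagonCount₂ , λ ()
    }
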